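{- Let $n\ge 3$ and $2\le\Delta\le n-1$ be integers. If there is a deterministic single-round algorithm in the CONGEST$(B)$ model that solves the triangle membership problem on all $n$-node graphs of maximum degree at most $\Delta$, then $$B \;\geq\; \log\left(\left(\frac{n-2}{2(\Delta-1)}\right)^{\Delta-1}\right).$$
   Context: CONGEST$(B)$ model (with $KT_1$ knowledge): the network is a simple undirected graph on $n$ nodes, each node having a unique ID in $[N]=\{1,\dots,N\}$, where $N\ge n$ is some polynomial in $n$. Initially each node knows its own ID and the IDs of its neighbors (and the global parameters such as $n$, $\Delta$, $N$), and nothing else about the graph. Computation proceeds in synchronous rounds; in each round each node sends a message of exactly $B$ bits to each of its neighbors (possibly different messages to different neighbors). The message sent in a round is a function of the initial knowledge of the node and the messages received in previous rounds; local computation is unbounded. After the last round each node produces an output determined by its initial knowledge and all messages it received. A deterministic single-round algorithm uses exactly one round of communication. An algorithm solves a problem on a class of graphs if it is correct for every graph in the class and every assignment of distinct IDs from $[N]$. Triangle membership problem: each node must output whether it is contained in a triangle of the graph. Logarithms are base 2. -}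

module Defs where

open import Algebra.Definitions.RawSemiring using () renaming (_^_ to pow)
open import Data.Bool using (Bool; true)
open import Data.Fin using (Fin; _≟_)
open import Data.Fin.Properties using (any?)
open import Data.Fin.Subset using (Subset; _∈_; _∉_; ∣_∣)
open import Data.Fin.Subset.Properties using (_∈?_)
open import Data.Integer using (+_)
open import Data.Maybe using (Maybe; is-just)
import Data.Maybe as Maybe
open import Data.Nat using (ℕ; zero; suc; _≤_; s≤s; z≤n; _*_; _∸_; NonZero)
open import Data.Product using (∃-syntax; _×_; proj₁)
open import Data.Rational as ℚ using (ℚ)
open import Data.Rational.Properties using (+-*-rawSemiring)
open import Data.Vec using (Vec; []; _∷_; tabulate; map)
open import Function using (_∘_; _⇔_; Injective)
open import Relation.Binary.PropositionalEquality using (_≡_)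
open import Relation.Nullary using (Dec)
open import Relation.Nullary.Decidable using (_×-dec_; dec⇒maybe)

record Graph (n : ℕ) : Set where
  field
    neighbours : Fin n → Subset n
    symmetric  : ∀ {u v} → v ∈ neighbours u → u ∈ neighbours v
    loopless   : ∀ {v} → v ∉ neighbours v

  Adjacent : Fin n → Fin n → Set
  Adjacent u v = v ∈ neighbours u

  degree : Fin n → ℕ
  degree v = ∣ neighbours v ∣

MaxDegree≤ : ℕ → ∀ {n} → Graph n → Set
MaxDegree≤ Δ G = ∀ v → Graph.degree G v ≤ Δ

InTriangle : ∀ {n} → Graph n → Fin n → Set
InTriangle G v = ∃[ u ] ∃[ w ] (Adjacent v u × Adjacent u w × Adjacent w v)
  where open Graph G

-- The ID space {1, …, N} is represented by Fin N.
record Network (n N : ℕ) : Set where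
  field
    graph        : Graph n
    ID           : Fin n → Fin N
    ID-injective : Injective _≡_ _≡_ ID

  open Graph graph public

  neighbourWithID? : ∀ v i → Dec (∃[ w ] (w ∈ neighbours v × ID w ≡ i))
  neighbourWithID? v i = any? λ w → (w ∈? neighbours v) ×-dec (ID w ≟ i)

  neighbourWithID : Fin n → Fin N → Maybe (Fin n)
  neighbourWithID v i = Maybe.map proj₁ (dec⇒maybe (neighbourWithID? v i))

  neighbourIDs : Fin n → Subset N
  neighbourIDs v = tabulate (is-just ∘ neighbourWithID v)

Message : ℕ → Set
Message B = Vec Bool B

-- The messages a node receives in one round, indexed by the ID of the sender;
-- the entry is nothing when no neighbour has that ID.
Inbox : ℕ → ℕ → Set
Inbox N B = Vec (Maybe (Message B)) N

-- The inboxes of the first t rounds, most recent first.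
History : ℕ → ℕ → ℕ → Set
History N B t = Vec (Inbox N B) t

-- A deterministic r-round CONGEST(B) algorithm with KT₁ knowledge and outputs
-- in O.  The first two arguments of send and output are the initial knowledge
-- of a node: its own ID and the set of its neighbours' IDs.  The last argument
-- of send is the ID of the addressee.  Only the values of send at t < r and
-- for addressees that are neighbours affect an execution.  Global parameters
-- such as n and Δ may influence the choice of the algorithm.
record Algorithm (N B r : ℕ) (O : Set) : Set where
  field
    send   : ∀ {t} → Fin N → Subset N → History N B t → Fin N → Message B
    output : Fin N → Subset N → History N B r → O

module Execution {n N B r : ℕ} {O : Set}
                 (A : Algorithm N B r O) (net : Network n N) where
  open Algorithm A
  open Network net

  mutual
    history : ∀ t → Fin n → History N B t
    history zero    v = []
    history (suc t) v = inbox t v ∷ history t v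

    inbox : ℕ → Fin n → Inbox N B
    inbox t v = tabulate λ i →
      Maybe.map (λ w → message t w v) (neighbourWithID v i)

    message : ℕ → Fin n → Fin n → Message B
    message t w v = send (ID w) (neighbourIDs w) (history t w) (ID v)

  result : Fin n → O
  result v = output (ID v) (neighbourIDs v) (history r v)

-- The outputs of the nodes that are correct on a given graph.
Problem : ℕ → Set → Set₁
Problem n O = Graph n → (Fin n → O) → Set

TriangleMembership : ∀ {n} → Problem n Bool
TriangleMembership G out = ∀ v → out v ≡ true ⇔ InTriangle G v

_Solves_On_ : ∀ {n N B r O} →
              Algorithm N B r O → Problem n O → (Graph n → Set) → Set
_Solves_On_ {n} {N} A P C =
  ∀ (net : Network n N) → let open Network net in
  C graph → P graph (Execution.result A net)

2[Δ∸1]≢0 : ∀ {Δ} → 2 ≤ Δ → NonZero (2 * (Δ ∸ 1))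
2[Δ∸1]≢0 (s≤s (s≤s z≤n)) = _

infixr 8 _^_
_^_ : ℚ → ℕ → ℚ
_^_ = pow +-*-rawSemiring

-- B ≥ log₂ x, for positive x, by monotonicity of the exponential with base 2.
infix 4 _≥log₂_
_≥log₂_ : ℕ → ℚ → Set
B ≥log₂ x = x ℚ.≤ (+ 2 ℚ./ 1) ^ B

{-# OPTIONS --safe #-}

-- Fix a node v.  For two other nodes w and u, say that w confuses u when some
-- two small neighbourhoods of w, both containing v but only one containing u,
-- make w send the same message to v.  If w and u confused each other, then v,
-- with neighbours w and u only, could not tell whether w and u are adjacent.
-- So "w does not confuse u" contains a tournament on the n - 1 nodes other than
-- v, and some w fails to confuse m ≥ (n - 2) / 2 of them.  The message of w
-- determines which of these m nodes are its neighbours.  A map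
-- Fin k → Fin m is then determined by the message for its range, together with
-- a map Fin k → Fin k into a fixed list of that range; hence
-- m ^ k ≤ 2 ^ B * k ^ k, where k = Δ - 1.
module Submission where

open import Defs
open import Algebra.Bundles using (CommutativeRing)
import Data.Bool as Bool
open import Data.Bool using (Bool; if_then_else_)
open import Data.Empty using (⊥)
open import Data.Fin using (Fin; zero; suc; combine; finToFun; funToFin; inject≤; punchIn; _≟_)
open import Data.Fin.Properties using
  (any?; 2↔Bool; combine-injective; finToFun-funToFin; funToFin-finToFin;
   inject≤-injective; injective⇒≤; punchInᵢ≢i; suc-injective)
open import Data.Fin.Subset using (Subset; inside; outside; _∈_; _∉_; _∪_; ⁅_⁆; ∣_∣)
  renaming (⊥ to ∅)
open import Data.Fin.Subset.Properties using
  (anySubset?; drop-there; p⊆q⇒∣p∣≤∣q∣; x∈p∪q⁺; x∈p∪q⁻; x∈⁅x⁆; x∈⁅y⁆⇒x≡y;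
   ∉⊥; ∣⁅x⁆∣≡1; ∣⊥∣≡0; ⊆-antisym; _∈?_)
open import Data.Integer using (+_; +≤+)
import Data.Integer as ℤ
import Data.Integer.Properties as ℤ
open import Data.Maybe using (Maybe; just; is-just)
import Data.Maybe as Maybe
open import Data.Nat using (ℕ; zero; suc; _+_; _≤_; _∸_; _*_; NonZero; z≤n; s≤s; _≤?_)
  renaming (_^_ to _^ℕ_)
open import Data.Nat.Properties using
  (+-0-commutativeMonoid; +-cancelˡ-≤; +-identityʳ; +-mono-≤; +-monoˡ-≤; +-monoʳ-≤; +-suc;
   *-identityʳ; *-comm; *-assoc; *-monoʳ-≤; [m*n]*[o*p]≡[m*o]*[n*p]; ^-monoˡ-≤; m^n≢0; n≤1+n;
   <⇒≤; ≰⇒>; ≤-reflexive; ≤-trans; module ≤-Reasoning)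
open import Data.Product using (∃-syntax; _×_; _,_; proj₁; proj₂)
open import Data.Rational using (ℚ; _/_; fromℚᵘ; toℚᵘ; Positive)
import Data.Rational as ℚ
open import Data.Rational.Properties using
  (+-*-commutativeRing; *-cancelʳ-≤-pos; fromℚᵘ-cong; toℚᵘ-cancel-≤; toℚᵘ-fromℚᵘ;
   toℚᵘ-homo-*; toℚᵘ-injective; normalize-pos)
open import Data.Rational.Unnormalised using (ℚᵘ; mkℚᵘ; *≡*; *≤*)
import Data.Rational.Unnormalised as ℚᵘ
import Data.Rational.Unnormalised.Properties as ℚᵘ
open import Data.Sum using (_⊎_; inj₁; inj₂; swap; [_,_]′)
open import Data.Vec using ([]; _∷_; here; there; tabulate)
open import Data.Vec.Properties using (lookup∘tabulate; lookup⇒[]=; []=⇒lookup; tabulate-cong; ≡-dec)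
open import Function using (_∘_; Injective; Inverse; Equivalence)
open import Relation.Binary.PropositionalEquality using
  (_≡_; _≢_; _≗_; refl; sym; trans; cong; cong₂; subst; module ≡-Reasoning)
open import Relation.Nullary using (Dec; yes; no; does; ¬_; contradiction)
open import Relation.Nullary.Decidable using
  (_×-dec_; _⊎-dec_; ¬?; dec⇒maybe; dec-true; recompute)
open import Level using (0ℓ)
open import Relation.Unary using (Pred; Decidable)
open import Algebra.Properties.CommutativeMonoid.Sum +-0-commutativeMonoid
  using (sum; sum-cong-≗; sum-remove; ∑-comm; ∑-distrib-+)
open import Algebra.Properties.CommutativeSemiring.Exp
  (CommutativeRing.commutativeSemiring +-*-commutativeRing)
  using (^-distrib-*)

-- Counting

^-distribʳ-* : ∀ k m n → (m * n) ^ℕ k ≡ m ^ℕ k * n ^ℕ k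
^-distribʳ-* zero    m n = refl
^-distribʳ-* (suc k) m n =
  trans (cong (m * n *_) (^-distribʳ-* k m n)) ([m*n]*[o*p]≡[m*o]*[n*p] m n (m ^ℕ k) (n ^ℕ k))

funToFin-cong : ∀ {m n} {f g : Fin m → Fin n} → f ≗ g → funToFin f ≡ funToFin g
funToFin-cong {zero}  f≗g = refl
funToFin-cong {suc m} f≗g = cong₂ combine (f≗g zero) (funToFin-cong (f≗g ∘ suc))

funToFin-injective : ∀ {m n} (f g : Fin m → Fin n) → funToFin f ≡ funToFin g → f ≗ g
funToFin-injective {m} {n} f g eq i =
  trans (sym (finToFun-funToFin f i))
        (trans (cong (λ x → finToFun {n} {m} x i) eq) (finToFun-funToFin g i))

-- A word is recovered from two data: its value under `h`, with at most `M` choices, and the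
-- position of each of its letters in one fixed word with that value, with `k ^ℕ k` choices. By
-- `covers`, every letter does occur in the fixed word.
range-determined⇒≤ : ∀ {m M k} (h : (Fin k → Fin m) → Fin M) →
  (∀ f g → h f ≡ h g → ∀ i → ∃[ j ] f i ≡ g j) → m ^ℕ k ≤ M * k ^ℕ k
range-determined⇒≤ {m} {M} {k} h covers = injective⇒≤ code-injective
  where
  word : Fin (m ^ℕ k) → Fin k → Fin m
  word = finToFun {m} {k}

  Preimage : Fin M → Set
  Preimage c = ∃[ y ] h (word y) ≡ c

  -- The irrelevant argument makes the preimage depend on c alone.
  preimage : ∀ c → .(Preimage c) → Preimage c
  preimage c = recompute (any? λ y → h (word y) ≟ c)

  fiber : Fin (m ^ℕ k) → Fin M
  fiber x = h (word x)

  canonical : ∀ c → .(Preimage c) → Fin k → Fin m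
  canonical c p = word (proj₁ (preimage c p))

  locate : ∀ x i → ∃[ j ] word x i ≡ canonical (fiber x) (x , refl) j
  locate x = covers _ _ (sym (proj₂ (preimage (fiber x) (x , refl))))

  positions : Fin (m ^ℕ k) → Fin k → Fin k
  positions x = proj₁ ∘ locate x

  code : Fin (m ^ℕ k) → Fin (M * k ^ℕ k)
  code x = combine (fiber x) (funToFin (positions x))

  -- Two words in the same fiber bring different evidence that the fiber is inhabited; irrelevance
  -- of this evidence makes their reference words coincide.
  canonical-cong : ∀ {c d} → c ≡ d → .(p : Preimage c) .(q : Preimage d) →
                   canonical c p ≗ canonical d q
  canonical-cong refl _ _ _ = refl

  code-injective : Injective _≡_ _≡_ code
  code-injective {x} {y} eq = begin
    x                  ≡⟨ funToFin-finToFin {k} {m} x ⟨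
    funToFin (word x)  ≡⟨ funToFin-cong pointwise ⟩
    funToFin (word y)  ≡⟨ funToFin-finToFin {k} {m} y ⟩
    y                  ∎
    where
    open ≡-Reasoning

    codes≡ : fiber x ≡ fiber y × funToFin (positions x) ≡ funToFin (positions y)
    codes≡ = combine-injective (fiber x) _ (fiber y) _ eq

    positions≗ : positions x ≗ positions y
    positions≗ = funToFin-injective _ _ (proj₂ codes≡)

    pointwise : word x ≗ word y
    pointwise i = begin
      word x i                              ≡⟨ proj₂ (locate x i) ⟩
      canonical (fiber x) _ (positions x i) ≡⟨ canonical-cong (proj₁ codes≡) _ _ _ ⟩
      canonical (fiber y) _ (positions x i) ≡⟨ cong (canonical (fiber y) _) (positions≗ i) ⟩
      canonical (fiber y) _ (positions y i) ≡⟨ proj₂ (locate y i) ⟨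
      word y i                              ∎

encode : ∀ {B} → Message B → Fin (2 ^ℕ B)
encode []      = zero
encode (b ∷ μ) = combine (Inverse.from 2↔Bool b) (encode μ)

encode-injective : ∀ {B} {μ ν : Message B} → encode μ ≡ encode ν → μ ≡ ν
encode-injective {μ = []}    {[]}    _  = refl
encode-injective {μ = b ∷ μ} {c ∷ ν} eq =
  let b≡c , μ≡ν = combine-injective (Inverse.from 2↔Bool b) (encode μ) _ _ eq
  in cong₂ _∷_ (trans (sym (Inverse.inverseˡ 2↔Bool refl))
                      (trans (cong (Inverse.to 2↔Bool) b≡c) (Inverse.inverseˡ 2↔Bool refl)))
               (encode-injective μ≡ν)

indicator : ∀ {P : Set} → Dec P → ℕ
indicator P? = if does P? then 1 else 0

indicator≥1 : ∀ {P : Set} (P? : Dec P) → P → 1 ≤ indicator P?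
indicator≥1 P? p rewrite dec-true P? p = s≤s z≤n

-- The domain is written as a sum of indicators so that its size is literally an out-degree in
-- `tournament-out-degree`.
enumerate : ∀ {n} {P : Pred (Fin n) 0ℓ} (P? : Decidable P) →
  ∃[ e ] Injective {A = Fin (sum (indicator ∘ P?))} _≡_ _≡_ e × (∀ i → P (e i))
enumerate {zero}  P? = (λ ()) , (λ { {()} }) , λ ()
enumerate {suc n} {P} P? with P? zero | enumerate (P? ∘ suc)
... | no _   | e , e-inj , Pe = suc ∘ e , e-inj ∘ suc-injective , Pe
... | yes p₀ | e , e-inj , Pe = e′ , e′-inj , Pe′
  where
  e′ : Fin (suc (sum (indicator ∘ P? ∘ suc))) → Fin (suc n)
  e′ zero    = zero
  e′ (suc i) = suc (e i)

  e′-inj : Injective _≡_ _≡_ e′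
  e′-inj {zero}  {zero}  _  = refl
  e′-inj {suc i} {suc j} eq = cong suc (e-inj (suc-injective eq))

  Pe′ : ∀ i → P (e′ i)
  Pe′ zero    = p₀
  Pe′ (suc i) = Pe i

sum-lower-bound : ∀ {n} c (t : Fin n → ℕ) → (∀ i → c ≤ t i) → n * c ≤ sum t
sum-lower-bound {zero}  c t c≤ = z≤n
sum-lower-bound {suc n} c t c≤ = +-mono-≤ (c≤ zero) (sum-lower-bound c (t ∘ suc) (c≤ ∘ suc))

-- If the first term is below `c`, removing it leaves terms whose average is still at least `c`, so
-- the search continues in the tail.
average≤some : ∀ {n} c (t : Fin (suc n) → ℕ) → suc n * c ≤ sum t → ∃[ i ] c ≤ t i
average≤some {n} c t h with c ≤? t zero
... | yes c≤t₀ = zero , c≤t₀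
average≤some {zero}  c t h | no c≰t₀ =
  contradiction (subst (c ≤_) (+-identityʳ (t zero)) (subst (_≤ sum t) (+-identityʳ c) h)) c≰t₀
average≤some {suc n} c t h | no c≰t₀ =
  let i , c≤ = average≤some c (t ∘ suc)
                 (+-cancelˡ-≤ c _ _ (≤-trans h (+-monoˡ-≤ _ (<⇒≤ (≰⇒> c≰t₀)))))
  in suc i , c≤

-- Double counting: summing `x w u + x u w` over all ordered pairs counts every weight twice, while
-- each of the `suc n` rows contributes at least `n`. Averaging over the rows yields `w`.
tournament-out-degree : ∀ {n} (x : Fin (suc n) → Fin (suc n) → ℕ) →
  (∀ {w u} → w ≢ u → 1 ≤ x w u + x u w) → ∃[ w ] n ≤ 2 * sum (x w)
tournament-out-degree {n} x total = average≤some n (λ w → 2 * sum (x w)) (begin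
  suc n * n                                            ≤⟨ sum-lower-bound n _ row ⟩
  sum (λ w → sum (λ u → x w u + x u w))                ≡⟨ double ⟩
  sum (λ w → 2 * sum (x w))                            ∎)
  where
  open ≤-Reasoning

  -- The indices `punchIn w j` run through the `n` vertices other than `w`; the diagonal term is
  -- bounded below by zero.
  row : ∀ w → n ≤ sum (λ u → x w u + x u w)
  row w = begin
    n                                                  ≡⟨ *-identityʳ n ⟨
    n * 1                                              ≤⟨ sum-lower-bound 1 _
                                                            (λ j → total (punchInᵢ≢i w j ∘ sym)) ⟩
    sum (λ j → x w (punchIn w j) + x (punchIn w j) w)  ≤⟨ +-monoˡ-≤ _ z≤n ⟩
    x w w + x w w + sum (λ j → x w (punchIn w j) + x (punchIn w j) w)
                                                       ≡⟨ sum-remove {i = w} (λ u → x w u + x u w) ⟨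
    sum (λ u → x w u + x u w)                          ∎

  double : sum (λ w → sum (λ u → x w u + x u w)) ≡ sum (λ w → 2 * sum (x w))
  double = begin-equality
    sum (λ w → sum (λ u → x w u + x u w))              ≡⟨ sum-cong-≗ (λ w → ∑-distrib-+ (x w) (λ u → x u w)) ⟩
    sum (λ w → sum (x w) + sum (λ u → x u w))          ≡⟨ ∑-distrib-+ (sum ∘ x) (λ w → sum (λ u → x u w)) ⟩
    sum (sum ∘ x) + sum (λ w → sum (λ u → x u w))      ≡⟨ cong (_+_ (sum (sum ∘ x))) (∑-comm (λ w u → x u w)) ⟩
    sum (sum ∘ x) + sum (sum ∘ x)                      ≡⟨ ∑-distrib-+ (sum ∘ x) (sum ∘ x) ⟨
    sum (λ w → sum (x w) + sum (x w))                  ≡⟨ sum-cong-≗ (λ w → cong (_+_ (sum (x w))) (+-identityʳ (sum (x w)))) ⟨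
    sum (λ w → 2 * sum (x w))                          ∎

-- Finite subsets

∣p∪q∣≤∣p∣+∣q∣ : ∀ {n} (p q : Subset n) → ∣ p ∪ q ∣ ≤ ∣ p ∣ + ∣ q ∣
∣p∪q∣≤∣p∣+∣q∣ []            []            = z≤n
∣p∪q∣≤∣p∣+∣q∣ (outside ∷ p) (outside ∷ q) = ∣p∪q∣≤∣p∣+∣q∣ p q
∣p∪q∣≤∣p∣+∣q∣ (outside ∷ p) (inside  ∷ q) =
  ≤-trans (s≤s (∣p∪q∣≤∣p∣+∣q∣ p q)) (≤-reflexive (sym (+-suc ∣ p ∣ ∣ q ∣)))
∣p∪q∣≤∣p∣+∣q∣ (inside  ∷ p) (outside ∷ q) = s≤s (∣p∪q∣≤∣p∣+∣q∣ p q)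
∣p∪q∣≤∣p∣+∣q∣ (inside  ∷ p) (inside  ∷ q) =
  s≤s (≤-trans (∣p∪q∣≤∣p∣+∣q∣ p q) (+-monoʳ-≤ ∣ p ∣ (n≤1+n ∣ q ∣)))

∣⁅x⁆∪p∣≤1+∣p∣ : ∀ {n} (x : Fin n) (p : Subset n) → ∣ ⁅ x ⁆ ∪ p ∣ ≤ suc ∣ p ∣
∣⁅x⁆∪p∣≤1+∣p∣ x p =
  ≤-trans (∣p∪q∣≤∣p∣+∣q∣ ⁅ x ⁆ p) (≤-reflexive (cong (λ s → s + ∣ p ∣) (∣⁅x⁆∣≡1 x)))

range : ∀ {k n} → (Fin k → Fin n) → Subset n
range {zero}  f = ∅
range {suc k} f = ⁅ f zero ⁆ ∪ range (f ∘ suc)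

∣range∣≤ : ∀ {k n} (f : Fin k → Fin n) → ∣ range f ∣ ≤ k
∣range∣≤ {zero}  {n} f = ≤-reflexive (∣⊥∣≡0 n)
∣range∣≤ {suc k}     f =
  ≤-trans (∣⁅x⁆∪p∣≤1+∣p∣ (f zero) (range (f ∘ suc))) (s≤s (∣range∣≤ (f ∘ suc)))

∈-range⁺ : ∀ {k n} (f : Fin k → Fin n) i → f i ∈ range f
∈-range⁺ f zero    = x∈p∪q⁺ (inj₁ (x∈⁅x⁆ (f zero)))
∈-range⁺ f (suc i) = x∈p∪q⁺ {p = ⁅ f zero ⁆} (inj₂ (∈-range⁺ (f ∘ suc) i))

∈-range⁻ : ∀ {k n} (f : Fin k → Fin n) {y} → y ∈ range f → ∃[ i ] y ≡ f i
∈-range⁻ {zero}  f y∈ = contradiction y∈ ∉⊥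
∈-range⁻ {suc k} f y∈ with x∈p∪q⁻ ⁅ f zero ⁆ (range (f ∘ suc)) y∈
... | inj₁ y∈₀ = zero , x∈⁅y⁆⇒x≡y (f zero) y∈₀
... | inj₂ y∈′ = let i , y≡ = ∈-range⁻ (f ∘ suc) y∈′ in suc i , y≡

module _ {n} {P : Pred (Fin n) 0ℓ} (P? : Decidable P) where

  abstract
    comprehension : Subset n
    comprehension = tabulate (does ∘ P?)

    ∈-comprehension⁺ : ∀ {y} → P y → y ∈ comprehension
    ∈-comprehension⁺ {y} p =
      lookup⇒[]= y comprehension (trans (lookup∘tabulate (does ∘ P?) y) (dec-true (P? y) p))

    ∈-comprehension⁻ : ∀ {y} → y ∈ comprehension → P y
    ∈-comprehension⁻ {y} y∈
      with P? y | trans (sym (lookup∘tabulate (does ∘ P?) y)) ([]=⇒lookup y∈)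
    ... | yes p | _  = p
    ... | no _  | ()

-- Graphs with two prescribed neighbourhoods

-- Vertex `zero` is the centre and `suc` embeds the others. The hubs `suc w` and `suc u` get the
-- prescribed neighbourhoods `S` and `T`, each enlarged by the centre. `S→T` and `T→S` say that both
-- prescriptions agree on whether the hubs are adjacent, which alone decides whether the centre lies
-- in a triangle.
module TwoHubs {a} {w u : Fin a} {S T : Subset a} (w≢u : w ≢ u)
               (w∉S : w ∉ S) (u∉T : u ∉ T) (S→T : u ∈ S → w ∈ T) (T→S : w ∈ T → u ∈ S) where

  private
    S⁺ T⁺ hubs : Subset (suc a)
    S⁺ = inside ∷ S
    T⁺ = inside ∷ T
    hubs = ⁅ suc w ⁆ ∪ ⁅ suc u ⁆

    Spoke Edge : Fin (suc a) → Fin (suc a) → Set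
    Spoke x y = (x ≡ suc w × y ∈ S⁺) ⊎ (x ≡ suc u × y ∈ T⁺)
    Edge x y = Spoke x y ⊎ Spoke y x

    spoke? : ∀ x y → Dec (Spoke x y)
    spoke? x y = ((x ≟ suc w) ×-dec (y ∈? S⁺)) ⊎-dec ((x ≟ suc u) ×-dec (y ∈? T⁺))

    edge? : ∀ x y → Dec (Edge x y)
    edge? x y = spoke? x y ⊎-dec spoke? y x

    ¬spoke-loop : ∀ {x} → ¬ Spoke x x
    ¬spoke-loop (inj₁ (refl , there w∈S)) = w∉S w∈S
    ¬spoke-loop (inj₂ (refl , there u∈T)) = u∉T u∈T

  graph : Graph (suc a)
  graph = record
    { neighbours = λ x → comprehension (edge? x)
    ; symmetric  = λ {x} {y} y∈ →
        ∈-comprehension⁺ (edge? y) (swap (∈-comprehension⁻ (edge? x) y∈))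
    ; loopless   = λ {x} x∈ → [ ¬spoke-loop , ¬spoke-loop ]′ (∈-comprehension⁻ (edge? x) x∈)
    }

  open Graph graph

  private
    -- Every edge has a hub at one end. This bounds the degree of all other vertices by 2 and
    -- confines the neighbours of the centre.
    edge⇒∈hubs : ∀ {x y} → x ≢ suc w → x ≢ suc u → Edge x y → y ∈ hubs
    edge⇒∈hubs x≢w x≢u (inj₁ (inj₁ (x≡w , _)))  = contradiction x≡w x≢w
    edge⇒∈hubs x≢w x≢u (inj₁ (inj₂ (x≡u , _)))  = contradiction x≡u x≢u
    edge⇒∈hubs x≢w x≢u (inj₂ (inj₁ (refl , _))) = x∈p∪q⁺ (inj₁ (x∈⁅x⁆ (suc w)))
    edge⇒∈hubs x≢w x≢u (inj₂ (inj₂ (refl , _))) =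
      x∈p∪q⁺ {p = ⁅ suc w ⁆} (inj₂ (x∈⁅x⁆ (suc u)))

    ∣hubs∣≤2 : ∣ hubs ∣ ≤ 2
    ∣hubs∣≤2 = ≤-trans (∣⁅x⁆∪p∣≤1+∣p∣ (suc w) ⁅ suc u ⁆) (s≤s (≤-reflexive (∣⁅x⁆∣≡1 (suc u))))

  hub₁-neighbours : neighbours (suc w) ≡ S⁺
  hub₁-neighbours =
    ⊆-antisym (edge⇒ ∘ ∈-comprehension⁻ (edge? (suc w)))
              (λ y∈ → ∈-comprehension⁺ (edge? (suc w)) (inj₁ (inj₁ (refl , y∈))))
    where
    edge⇒ : ∀ {y} → Edge (suc w) y → y ∈ S⁺
    edge⇒ (inj₁ (inj₁ (_ , y∈)))             = y∈
    edge⇒ (inj₁ (inj₂ (w≡u , _)))            = contradiction (suc-injective w≡u) w≢u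
    edge⇒ (inj₂ (inj₁ (_ , there w∈S)))      = contradiction w∈S w∉S
    -- This edge was contributed by the other hub; agreement of the prescriptions shows that it is
    -- already listed in `S`.
    edge⇒ (inj₂ (inj₂ (refl , there w∈T)))   = there (T→S w∈T)

  hub₂-neighbours : neighbours (suc u) ≡ T⁺
  hub₂-neighbours =
    ⊆-antisym (edge⇒ ∘ ∈-comprehension⁻ (edge? (suc u)))
              (λ y∈ → ∈-comprehension⁺ (edge? (suc u)) (inj₁ (inj₂ (refl , y∈))))
    where
    edge⇒ : ∀ {y} → Edge (suc u) y → y ∈ T⁺
    edge⇒ (inj₁ (inj₁ (u≡w , _)))            = contradiction (sym (suc-injective u≡w)) w≢u
    edge⇒ (inj₁ (inj₂ (_ , y∈)))             = y∈
    edge⇒ (inj₂ (inj₁ (refl , there u∈S)))   = there (S→T u∈S)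
    edge⇒ (inj₂ (inj₂ (_ , there u∈T)))      = contradiction u∈T u∉T

  centre-neighbours : neighbours zero ≡ ⁅ suc w ⁆ ∪ ⁅ suc u ⁆
  centre-neighbours =
    ⊆-antisym (edge⇒∈hubs (λ ()) (λ ()) ∘ ∈-comprehension⁻ (edge? zero))
              (∈-comprehension⁺ (edge? zero) ∘ edge⇐)
    where
    edge⇐ : ∀ {y} → y ∈ hubs → Edge zero y
    edge⇐ y∈ with x∈p∪q⁻ ⁅ suc w ⁆ ⁅ suc u ⁆ y∈
    ... | inj₁ y∈₁ = inj₂ (inj₁ (x∈⁅y⁆⇒x≡y (suc w) y∈₁ , here))
    ... | inj₂ y∈₂ = inj₂ (inj₂ (x∈⁅y⁆⇒x≡y (suc u) y∈₂ , here))

  maxDegree : ∀ {k} → 1 ≤ k → ∣ S ∣ ≤ k → ∣ T ∣ ≤ k → MaxDegree≤ (suc k) graph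
  maxDegree {k} 1≤k ∣S∣≤k ∣T∣≤k x = by-cases (x ≟ suc w) (x ≟ suc u)
    where
    by-cases : ∀ {x} → Dec (x ≡ suc w) → Dec (x ≡ suc u) → degree x ≤ suc k
    by-cases (yes refl) _ = subst (λ p → ∣ p ∣ ≤ suc k) (sym hub₁-neighbours) (s≤s ∣S∣≤k)
    by-cases (no _) (yes refl) = subst (λ p → ∣ p ∣ ≤ suc k) (sym hub₂-neighbours) (s≤s ∣T∣≤k)
    -- A vertex that is not a hub may have degree 2, which fits the bound `suc k` because `1 ≤ k`.
    by-cases {x} (no x≢w) (no x≢u) =
      ≤-trans (p⊆q⇒∣p∣≤∣q∣ (edge⇒∈hubs x≢w x≢u ∘ ∈-comprehension⁻ (edge? x)))
              (≤-trans ∣hubs∣≤2 (s≤s 1≤k))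

  ∈-centre⁻ : ∀ {x} → x ∈ neighbours zero → x ≡ suc w ⊎ x ≡ suc u
  ∈-centre⁻ x∈ with x∈p∪q⁻ ⁅ suc w ⁆ ⁅ suc u ⁆ (subst (_ ∈_) centre-neighbours x∈)
  ... | inj₁ x∈₁ = inj₁ (x∈⁅y⁆⇒x≡y (suc w) x∈₁)
  ... | inj₂ x∈₂ = inj₂ (x∈⁅y⁆⇒x≡y (suc u) x∈₂)

  ∈⇒triangle : u ∈ S → InTriangle graph zero
  ∈⇒triangle u∈S = suc w , suc u
    , symmetric {suc w} (subst (zero ∈_) (sym hub₁-neighbours) here)
    , subst (suc u ∈_) (sym hub₁-neighbours) (there u∈S)
    , subst (zero ∈_) (sym hub₂-neighbours) here

  -- The other two corners are neighbours of the centre, hence hubs, and they are distinct because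
  -- there are no loops.
  triangle⇒∈ : InTriangle graph zero → u ∈ S
  triangle⇒∈ (x , y , vx , xy , yv) with ∈-centre⁻ {x} vx | ∈-centre⁻ {y} (symmetric {y} yv)
  ... | inj₁ refl | inj₁ refl = contradiction xy (loopless {suc w})
  ... | inj₁ refl | inj₂ refl = drop-there (subst (suc u ∈_) hub₁-neighbours xy)
  ... | inj₂ refl | inj₁ refl = drop-there (subst (suc u ∈_) hub₁-neighbours (symmetric {suc u} xy))
  ... | inj₂ refl | inj₂ refl = contradiction xy (loopless {suc u})

-- Single-round executions

module SingleRound {n N B} {O : Set} (A : Algorithm N B 1 O)
                   (ID : Fin n → Fin N) (ID-injective : Injective _≡_ _≡_ ID) where
  open Algorithm A

  network : Graph n → Network n N
  network G = record { graph = G ; ID = ID ; ID-injective = ID-injective }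

  result : Graph n → Fin n → O
  result G = Execution.result A (network G)

  abstract
    private
      -- The neighbour lookup of `Network`, taking a neighbour set in place of a graph. This exposes
      -- that initial knowledge and first messages depend on the graph only through the node's own
      -- neighbourhood.
      sender? : ∀ s i → Dec (∃[ x ] (x ∈ s × ID x ≡ i))
      sender? s i = any? λ x → (x ∈? s) ×-dec (ID x ≟ i)

      sender : Subset n → Fin N → Maybe (Fin n)
      sender s i = Maybe.map proj₁ (dec⇒maybe (sender? s i))

      knowledge : Subset n → Subset N
      knowledge s = tabulate (is-just ∘ sender s)

    firstMessage : Fin n → Subset n → Fin n → Message B
    firstMessage x s v = send (ID x) (knowledge s) [] (ID v)

    private
      received : Subset n → (Fin n → Message B) → Inbox N B
      received s μ = tabulate λ i → Maybe.map μ (sender s i)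

      received-cong : ∀ s {μ ν} → (∀ {x} → x ∈ s → μ x ≡ ν x) → received s μ ≡ received s ν
      received-cong s {μ} {ν} μ≡ν = tabulate-cong pointwise
        where
        pointwise : ∀ i → Maybe.map μ (sender s i) ≡ Maybe.map ν (sender s i)
        pointwise i with sender? s i
        ... | yes (x , x∈s , _) = cong just (μ≡ν x∈s)
        ... | no _              = refl

    -- After one round a node has seen only its own neighbour set and its neighbours' messages, each
    -- of which was sent with an empty history.
    result-cong : ∀ (G H : Graph n) {v} → Graph.neighbours G v ≡ Graph.neighbours H v →
      (∀ {x} → x ∈ Graph.neighbours G v →
        firstMessage x (Graph.neighbours G x) v ≡ firstMessage x (Graph.neighbours H x) v) →
      result G v ≡ result H v
    result-cong G H {v} G≡H messages≡ = begin
      -- The messages are exchanged first, with the neighbour set of `G` fixed, because they are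
      -- known to agree only on that set.
      respond (Graph.neighbours G v) (μ G)   ≡⟨ cong (λ m → output (ID v) (knowledge _) (m ∷ []))
                                                  (received-cong _ messages≡) ⟩
      respond (Graph.neighbours G v) (μ H)   ≡⟨ cong (λ s → respond s (μ H)) G≡H ⟩
      respond (Graph.neighbours H v) (μ H)   ∎
      where
      open ≡-Reasoning

      respond : Subset n → (Fin n → Message B) → O
      respond t ν = output (ID v) (knowledge t) (received t ν ∷ [])

      μ : Graph n → Fin n → Message B
      μ K x = firstMessage x (Graph.neighbours K x) v

-- The lower bound

-- Here `n` is `suc (suc a)` and `Δ` is `suc k`: there are `suc a` nodes besides `zero`, and a
-- neighbour of `zero` has at most `k` further neighbours.
module LowerBound {a k N B} (1≤k : 1 ≤ k) (ID : Fin (suc (suc a)) → Fin N)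
                  (ID-injective : Injective _≡_ _≡_ ID) (A : Algorithm N B 1 Bool)
                  (solves : A Solves (TriangleMembership {suc (suc a)}) On (MaxDegree≤ (suc k))) where

  open SingleRound A ID ID-injective

  -- The node whose output is studied is zero; S lists the other neighbours of suc w.
  message : Fin (suc a) → Subset (suc a) → Message B
  message w S = firstMessage (suc w) (inside ∷ S) zero

  Small : Fin (suc a) → Subset (suc a) → Set
  Small w S = ∣ S ∣ ≤ k × w ∉ S

  small? : ∀ w S → Dec (Small w S)
  small? w S = (∣ S ∣ ≤? k) ×-dec ¬? (w ∈? S)

  Confuses : Fin (suc a) → Fin (suc a) → Set
  Confuses w u = ∃[ S ] ∃[ S′ ]
    (Small w S × Small w S′ × u ∈ S × u ∉ S′ × message w S ≡ message w S′)

  abstract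
    confuses? : ∀ w u → Dec (Confuses w u)
    confuses? w u = anySubset? λ S → anySubset? λ S′ →
      small? w S ×-dec small? w S′ ×-dec (u ∈? S) ×-dec ¬? (u ∈? S′) ×-dec
      ≡-dec Bool._≟_ (message w S) (message w S′)

  -- The unprimed sets give a graph in which the hubs are adjacent, the primed sets one in which
  -- they are not. Node `zero` has the same neighbours and receives the same messages in both, so
  -- correctness on the first forces a triangle in the second.
  ¬mutually-confusing : ∀ {w u} → w ≢ u → Confuses w u → Confuses u w → ⊥
  ¬mutually-confusing {w} {u} w≢u
    (S , S′ , (∣S∣≤k , w∉S) , (∣S′∣≤k , w∉S′) , u∈S , u∉S′ , μS≡μS′)
    (T , T′ , (∣T∣≤k , u∉T) , (∣T′∣≤k , u∉T′) , w∈T , w∉T′ , μT≡μT′) =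
    u∉S′ (G′.triangle⇒∈ (Equivalence.to (solves (network G′.graph) degrees′ zero)
      (trans (sym same) (Equivalence.from (solves (network G.graph) degrees zero)
        (G.∈⇒triangle u∈S)))))
    where
    -- The prescriptions agree in `G` because each hub lists the other, and in `G′` because neither
    -- does.
    module G  = TwoHubs w≢u w∉S  u∉T  (λ _ → w∈T) (λ _ → u∈S)
    module G′ = TwoHubs w≢u w∉S′ u∉T′ (λ p → contradiction p u∉S′) (λ p → contradiction p w∉T′)

    degrees  = G.maxDegree  1≤k ∣S∣≤k  ∣T∣≤k
    degrees′ = G′.maxDegree 1≤k ∣S′∣≤k ∣T′∣≤k

    transfer : ∀ {x p q p′ q′} → p ≡ q → p′ ≡ q′ → firstMessage x q zero ≡ firstMessage x q′ zero →
               firstMessage x p zero ≡ firstMessage x p′ zero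
    transfer refl refl eq = eq

    messages≡ : ∀ {x} → x ≡ suc w ⊎ x ≡ suc u →
      firstMessage x (Graph.neighbours G.graph x) zero ≡ firstMessage x (Graph.neighbours G′.graph x) zero
    messages≡ (inj₁ refl) = transfer G.hub₁-neighbours G′.hub₁-neighbours μS≡μS′
    messages≡ (inj₂ refl) = transfer G.hub₂-neighbours G′.hub₂-neighbours μT≡μT′

    same : result G.graph zero ≡ result G′.graph zero
    same = result-cong G.graph G′.graph (trans G.centre-neighbours (sym G′.centre-neighbours))
                       (messages≡ ∘ G.∈-centre⁻)

  -- Requiring `w ≢ u` keeps `w` out of every neighbourhood assembled from the nodes that it
  -- resolves.
  Resolves : Fin (suc a) → Fin (suc a) → Set
  Resolves w u = w ≢ u × ¬ Confuses w u

  resolves? : ∀ w u → Dec (Resolves w u)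
  resolves? w u = ¬? (w ≟ u) ×-dec ¬? (confuses? w u)

  resolves-total : ∀ {w u} → w ≢ u → 1 ≤ indicator (resolves? w u) + indicator (resolves? u w)
  resolves-total {w} {u} w≢u = by-cases (confuses? w u)
    where
    by-cases : Dec (Confuses w u) → 1 ≤ indicator (resolves? w u) + indicator (resolves? u w)
    by-cases (no ¬c) = +-mono-≤ (indicator≥1 (resolves? w u) (w≢u , ¬c)) z≤n
    by-cases (yes c) = +-mono-≤ {0} z≤n
      (indicator≥1 (resolves? u w) (w≢u ∘ sym , ¬mutually-confusing w≢u c))

  -- A map into the resolved nodes, injective or not, has a range of size at most `k`, a legitimate
  -- neighbourhood for `w`. If two ranges gave the same message and one held a node missing from the
  -- other, `w` would confuse that node, contrary to its being resolved.
  resolved^k≤ : ∀ w → sum (indicator ∘ resolves? w) ^ℕ k ≤ 2 ^ℕ B * k ^ℕ k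
  resolved^k≤ w = range-determined⇒≤ (λ f → encode (message w (neighbourhood f))) covers
    where
    enumeration = enumerate (resolves? w)
    e = proj₁ enumeration
    e-injective = proj₁ (proj₂ enumeration)
    resolves-e = proj₂ (proj₂ enumeration)

    neighbourhood : (Fin k → Fin _) → Subset (suc a)
    neighbourhood f = range (e ∘ f)

    small : ∀ f → Small w (neighbourhood f)
    small f = ∣range∣≤ (e ∘ f) , λ w∈ →
      let i , w≡ = ∈-range⁻ (e ∘ f) w∈ in proj₁ (resolves-e (f i)) w≡

    covers : ∀ f g → encode (message w (neighbourhood f)) ≡ encode (message w (neighbourhood g)) →
             ∀ i → ∃[ j ] f i ≡ g j
    covers f g eq i with e (f i) ∈? neighbourhood g
    ... | yes ∈g = let j , efi≡egj = ∈-range⁻ (e ∘ g) ∈g in j , e-injective efi≡egj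
    ... | no ∉g  = contradiction
      (_ , _ , small f , small g , ∈-range⁺ (e ∘ f) i , ∉g , encode-injective eq)
      (proj₂ (resolves-e (f i)))

  -- By the tournament argument on `suc a` nodes some `w` resolves `m` nodes with `a ≤ 2 * m`. The
  -- factor `2 ^ℕ k` lost in passing from `a` to `m` is absorbed into `(2 * k) ^ℕ k`.
  bound : a ^ℕ k ≤ 2 ^ℕ B * (2 * k) ^ℕ k
  bound = begin
    a ^ℕ k                        ≤⟨ ^-monoˡ-≤ k a≤2m ⟩
    (2 * m) ^ℕ k                  ≡⟨ ^-distribʳ-* k 2 m ⟩
    2 ^ℕ k * m ^ℕ k               ≤⟨ *-monoʳ-≤ (2 ^ℕ k) (resolved^k≤ w) ⟩
    2 ^ℕ k * (2 ^ℕ B * k ^ℕ k)    ≡⟨ *-assoc (2 ^ℕ k) (2 ^ℕ B) (k ^ℕ k) ⟨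
    2 ^ℕ k * 2 ^ℕ B * k ^ℕ k      ≡⟨ cong (_* k ^ℕ k) (*-comm (2 ^ℕ k) (2 ^ℕ B)) ⟩
    2 ^ℕ B * 2 ^ℕ k * k ^ℕ k      ≡⟨ *-assoc (2 ^ℕ B) (2 ^ℕ k) (k ^ℕ k) ⟩
    2 ^ℕ B * (2 ^ℕ k * k ^ℕ k)    ≡⟨ cong (2 ^ℕ B *_) (^-distribʳ-* k 2 k) ⟨
    2 ^ℕ B * (2 * k) ^ℕ k         ∎
    where
    open ≤-Reasoning

    best : ∃[ w ] a ≤ 2 * sum (indicator ∘ resolves? w)
    best = tournament-out-degree (λ w u → indicator (resolves? w u)) resolves-total

    w    = proj₁ best
    a≤2m = proj₂ best
    m    = sum (indicator ∘ resolves? w)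

-- Passing to the rationals

fromℚᵘ-homo-* : ∀ p q → fromℚᵘ (p ℚᵘ.* q) ≡ fromℚᵘ p ℚ.* fromℚᵘ q
fromℚᵘ-homo-* p q = toℚᵘ-injective (begin
  toℚᵘ (fromℚᵘ (p ℚᵘ.* q))               ≈⟨ toℚᵘ-fromℚᵘ (p ℚᵘ.* q) ⟩
  p ℚᵘ.* q                               ≈⟨ ℚᵘ.*-cong (toℚᵘ-fromℚᵘ p) (toℚᵘ-fromℚᵘ q) ⟨
  toℚᵘ (fromℚᵘ p) ℚᵘ.* toℚᵘ (fromℚᵘ q)   ≈⟨ toℚᵘ-homo-* (fromℚᵘ p) (fromℚᵘ q) ⟨
  toℚᵘ (fromℚᵘ p ℚ.* fromℚᵘ q)           ∎)
  where open import Relation.Binary.Reasoning.Setoid ℚᵘ.≃-setoid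

ι : ℕ → ℚ
ι n = + n / 1

ι-homo-* : ∀ m n → ι (m * n) ≡ ι m ℚ.* ι n
ι-homo-* m n =
  trans (cong (λ z → z / 1) (ℤ.pos-* m n)) (fromℚᵘ-homo-* (mkℚᵘ (+ m) 0) (mkℚᵘ (+ n) 0))

ι-homo-^ : ∀ m k → ι (m ^ℕ k) ≡ ι m ^ k
ι-homo-^ m zero    = refl
ι-homo-^ m (suc k) = trans (ι-homo-* m (m ^ℕ k)) (cong (ι m ℚ.*_) (ι-homo-^ m k))

ι-mono-≤ : ∀ {m n} → m ≤ n → ι m ℚ.≤ ι n
ι-mono-≤ {m} {n} m≤n = toℚᵘ-cancel-≤ (begin
  toℚᵘ (ι m)     ≃⟨ toℚᵘ-fromℚᵘ (mkℚᵘ (+ m) 0) ⟩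
  mkℚᵘ (+ m) 0   ≤⟨ *≤* (ℤ.*-monoʳ-≤-nonNeg (+ 1) (+≤+ m≤n)) ⟩
  mkℚᵘ (+ n) 0   ≃⟨ toℚᵘ-fromℚᵘ (mkℚᵘ (+ n) 0) ⟨
  toℚᵘ (ι n)     ∎)
  where open ℚᵘ.≤-Reasoning

m/d*ιd≡ιm : ∀ m d .{{_ : NonZero d}} → (+ m / d) ℚ.* ι d ≡ ι m
m/d*ιd≡ιm m d@(suc d-1) = begin
  (+ m / d) ℚ.* ι d                           ≡⟨ fromℚᵘ-homo-* (mkℚᵘ (+ m) d-1) (mkℚᵘ (+ d) 0) ⟨
  fromℚᵘ (mkℚᵘ (+ m) d-1 ℚᵘ.* mkℚᵘ (+ d) 0)   ≡⟨ fromℚᵘ-cong {x} {y} (*≡* cross) ⟩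
  ι m                                         ∎
  where
  open ≡-Reasoning

  x y : ℚᵘ
  x = mkℚᵘ (+ m) d-1 ℚᵘ.* mkℚᵘ (+ d) 0
  y = mkℚᵘ (+ m) 0

  cross : + m ℤ.* + d ℤ.* + 1 ≡ + m ℤ.* + (d * 1)
  cross = trans (ℤ.*-identityʳ (+ m ℤ.* + d)) (cong (λ e → + m ℤ.* + e) (sym (*-identityʳ d)))

-- Multiplying by the positive number `d ^ℕ k` clears the denominator and leaves an inequality
-- between natural numbers.
≥log₂-quotient-^ : ∀ {B} m d .{{_ : NonZero d}} k → m ^ℕ k ≤ 2 ^ℕ B * d ^ℕ k → B ≥log₂ (+ m / d) ^ k
≥log₂-quotient-^ {B} m d k m^k≤ = *-cancelʳ-≤-pos (ι (d ^ℕ k)) (begin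
  (+ m / d) ^ k ℚ.* ι (d ^ℕ k)   ≡⟨ cong ((+ m / d) ^ k ℚ.*_) (ι-homo-^ d k) ⟩
  (+ m / d) ^ k ℚ.* ι d ^ k      ≡⟨ ^-distrib-* (+ m / d) (ι d) k ⟨
  ((+ m / d) ℚ.* ι d) ^ k        ≡⟨ cong (_^ k) (m/d*ιd≡ιm m d) ⟩
  ι m ^ k                        ≡⟨ ι-homo-^ m k ⟨
  ι (m ^ℕ k)                     ≤⟨ ι-mono-≤ m^k≤ ⟩
  ι (2 ^ℕ B * d ^ℕ k)            ≡⟨ ι-homo-* (2 ^ℕ B) (d ^ℕ k) ⟩
  ι (2 ^ℕ B) ℚ.* ι (d ^ℕ k)      ≡⟨ cong (ℚ._* ι (d ^ℕ k)) (ι-homo-^ 2 B) ⟩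
  ι 2 ^ B ℚ.* ι (d ^ℕ k)         ∎)
  where
  open Data.Rational.Properties.≤-Reasoning
  instance
    ι-positive : Positive (ι (d ^ℕ k))
    ι-positive = normalize-pos (d ^ℕ k) 1 {{_}} {{m^n≢0 d k}}

theorem2 : (n Δ N B : ℕ) → 3 ≤ n → (2≤Δ : 2 ≤ Δ) → Δ ≤ n ∸ 1 → n ≤ N →
    (A : Algorithm N B 1 Bool) →
    A Solves (TriangleMembership {n}) On (MaxDegree≤ Δ) →
    let instance
          nonZero : NonZero (2 * (Δ ∸ 1))
          nonZero = 2[Δ∸1]≢0 2≤Δ
    in B ≥log₂ ((+ (n ∸ 2)) / (2 * (Δ ∸ 1))) ^ (Δ ∸ 1)
theorem2 (suc (suc a)) (suc k) N B _ 2≤Δ@(s≤s 1≤k) _ n≤N A solves =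
  ≥log₂-quotient-^ {B} a (2 * k) {{2[Δ∸1]≢0 2≤Δ}} k
    -- One assignment of distinct IDs suffices for the bound; `n ≤ N` provides the initial segment
    -- of the ID space.
    (LowerBound.bound 1≤k (λ x → inject≤ x n≤N) (inject≤-injective n≤N n≤N _ _) A solves)
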